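{- For every even integer $\nu\ge 4$, $\varepsilon(\nu,1)=\nu+2$.
   Context: All graphs are finite, connected and simple. A connected graph $G$ on $\nu$ vertices is $k$-extendable, where $k$ is an integer with $0\le k\le (\nu-2)/2$, if $G$ contains a matching of size $k$ and every matching of size $k$ in $G$ is contained in a perfect matching of $G$. For an integer $k\ge 1$ and an even integer $\nu\ge 2k+2$, $\varepsilon(\nu,k)$ denotes the minimum number of edges of a $k$-extendable non-bipartite graph on $\nu$ vertices. -}

module Defs where

open import Data.Bool.Base using (Bool; false; T)
open import Data.Bool.Properties using (T?)
open import Data.Fin.Base using (Fin)
open import Data.Fin.Properties using (_<?_)
open import Data.List.Base using (List; length; filter; allFin; cartesianProduct)
open import Data.Nat.Base as ℕ using (ℕ; _≤_)
open import Data.Product.Base using (_×_; _,_; ∃-syntax; Σ-syntax)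
open import Level using (0ℓ)
open import Relation.Binary.Construct.Closure.ReflexiveTransitive using (Star)
open import Relation.Binary.PropositionalEquality using (_≡_; _≢_)
open import Relation.Nullary.Decidable.Core using (_×-dec_)
open import Relation.Nullary.Negation.Core using (¬_)
open import Relation.Unary using (Pred)

-- Adjacency is Bool-valued, so that a graph is finite data and edges can be
-- counted.
record Graph (n : ℕ) : Set where
  field
    adj    : Fin n → Fin n → Bool
    sym    : ∀ u v → adj u v ≡ adj v u
    irrefl : ∀ v → adj v v ≡ false

  _~_ : Fin n → Fin n → Set
  u ~ v = T (adj u v)

  -- Each edge {u , v} is listed once, as the pair with u < v.
  edges : List (Fin n × Fin n)
  edges = filter (λ (u , v) → (u <? v) ×-dec T? (adj u v))
                 (cartesianProduct (allFin n) (allFin n))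

  ∣E∣ : ℕ
  ∣E∣ = length edges

open Graph public using (∣E∣)

Connected : ∀ {n} → Graph n → Set
Connected G = ∀ u v → Star _~_ u v
  where open Graph G

Bipartite : ∀ {n} → Graph n → Set
Bipartite {n} G = Σ[ side ∈ (Fin n → Bool) ] (∀ u v → u ~ v → side u ≢ side v)
  where open Graph G

-- A set of edges on the vertex set Fin n is the same data as a simple graph on
-- Fin n, so matchings are also represented by Graph n; their size is ∣E∣.
_⊆_ : ∀ {n} → Graph n → Graph n → Set
M ⊆ G = ∀ u v → Graph._~_ M u v → Graph._~_ G u v

record IsMatching {n} (G M : Graph n) : Set where
  open Graph M using (_~_)
  field
    subset   : M ⊆ G
    disjoint : ∀ u v w → u ~ v → u ~ w → v ≡ w

record IsPerfectMatching {n} (G M : Graph n) : Set where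
  open Graph M using (_~_)
  field
    isMatching : IsMatching G M
    covers     : ∀ u → ∃[ v ] u ~ v

record Extendable {n} (k : ℕ) (G : Graph n) : Set where
  field
    connected : Connected G
    bound     : 2 ℕ.* k ℕ.+ 2 ≤ n
    matching  : ∃[ M ] IsMatching G M × ∣E∣ M ≡ k
    extends   : ∀ M → IsMatching G M → ∣E∣ M ≡ k →
                ∃[ P ] IsPerfectMatching G P × M ⊆ P

IsMinimum : Pred ℕ 0ℓ → Pred ℕ 0ℓ
IsMinimum P m = P m × (∀ l → P l → m ≤ l)

-- ε is rendered as a relation: ε[ ν , k ]≡ m says that the minimum ε(ν,k) exists
-- and equals m. It is meant for k ≥ 1 and even ν ≥ 2k + 2.
ε[_,_]≡_ : ℕ → ℕ → ℕ → Set
ε[ ν , k ]≡ m = IsMinimum EdgeCount m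
  where
  EdgeCount : Pred ℕ 0ℓ
  EdgeCount e = ∃[ G ] Extendable {ν} k G × ¬ Bipartite G × ∣E∣ G ≡ e

{-# OPTIONS --safe #-}
module Submission where

-- Lower bound: n + deg w ≤ |E| + 1 for every vertex w. Choose a perfect matching
-- Pᵢ through each edge w vᵢ. If the bound failed, the |E| + 1 linear equations ∑
-- cᵢ = 0 and y u + y v + z u v = 0 (uv an edge), where z = ∑ cᵢ χ(Pᵢ), in n +
-- deg w unknowns, would have a nonzero integer solution (y , c). The row sums of
-- z vanish, so z is orthogonal to the matrix (y u + y v), hence to itself, and z
-- = 0; its row w gives c = 0, and y alternates in sign along edges, so y = 0
-- because the graph is connected and not bipartite. Summing the bound over w
-- gives |E| ≥ n + 2. Equality holds for K₄ with one edge subdivided an even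
-- number of times, a union of three perfect matchings.

open import Defs
open import Data.Nat.Base using (ℕ; _+_; _≤_)
open import Data.Nat.Divisibility using (_∣_)
open import Algebra.Bundles using (AbelianGroup)
open import Algebra.Properties.Group using (inverseʳ-unique)
open import Data.Bool.Base using (Bool; true; false; T; if_then_else_)
open import Data.Bool.Properties using (T?)
open import Data.Empty using (⊥; ⊥-elim)
open import Data.Fin.Base as Fin using (Fin; zero; suc; punchIn; splitAt; join; _↑ˡ_; _↑ʳ_)
open import Data.Fin.Properties
  using (_≟_; _<?_; <-cmp; <-irrefl; <-asym; injective⇒≤; join-splitAt; punchInᵢ≢i; suc-injective)
open import Data.Integer.Base as ℤ using (ℤ; 0ℤ; 1ℤ; -[1+_]; +[1+_])
import Data.Integer.Properties as ℤ
import Data.Integer.Tactic.RingSolver as ℤ-Solver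
open import Data.List.Base
  using (List; []; _∷_; [_]; _++_; map; length; lookup; filter; allFin; tabulate; concatMap; cartesianProduct)
open import Data.List.Membership.Propositional using (_∈_; lose)
open import Data.List.Membership.Propositional.Properties
  using (∈-lookup; ∈-filter⁺; ∈-filter⁻; ∈-allFin; ∈-cartesianProduct⁺; ∈-concatMap⁺; ∈-map⁺; ∈-map⁻; ∈-++⁻)
open import Data.List.Properties using (length-++; length-map)
open import Data.List.Relation.Unary.All as All using (All; []; _∷_)
import Data.List.Relation.Unary.All.Properties as All
open import Data.List.Relation.Unary.AllPairs using ([]; _∷_)
open import Data.List.Relation.Unary.Any as Any using (here; there)
open import Data.List.Relation.Unary.Any.Properties using (lookup-index)
open import Data.List.Relation.Unary.Unique.Propositional using (Unique)
import Data.List.Relation.Unary.Unique.Propositional.Properties as Unique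
open import Data.Nat.Base using (zero; suc; _*_; _<_; z≤n; s≤s)
open import Data.Nat.Divisibility using (divides)
import Data.Nat.Properties as ℕ
import Data.Nat.Tactic.RingSolver as ℕ-Solver
open import Data.Product.Base using (_×_; _,_; proj₁; proj₂; ∃-syntax; swap)
open import Data.Sum.Base using (_⊎_; inj₁; inj₂; [_,_]′)
open import Data.Vec.Functional using (removeAt; insertAt)
open import Data.Vec.Functional.Properties using (insertAt-lookup; insertAt-punchIn)
open import Function.Base using (_∘_; id)
open import Function.Bundles using (mk⇔)
open import Level using (0ℓ)
open import Relation.Binary.Construct.Closure.ReflexiveTransitive
  using (Star; ε; _◅_; _◅◅_; gmap; kleisliStar; reverse)
open import Relation.Binary.Core using (Rel)
open import Relation.Binary.Definitions using (Decidable; Symmetric; tri<; tri≈; tri>)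
open import Relation.Binary.PropositionalEquality
  using (_≡_; _≢_; refl; sym; trans; cong; cong₂; subst; module ≡-Reasoning)
open import Relation.Nullary using (¬_; Dec; yes; no; does; contradiction)
open import Relation.Nullary.Decidable using (does-⇔; decidable-stable; _×-dec_; _⊎-dec_)

open import Algebra.Properties.CommutativeMonoid.Sum ℕ.+-0-commutativeMonoid
  using () renaming (sum to sumℕ)
open import Algebra.Properties.Semiring.Sum ℤ.+-*-semiring
  using (sum; sum-remove; sum-cong-≗; sum-replicate-zero; ∑-distrib-+; ∑-comm; *-distribˡ-sum)

-- Counting with duplicate-free lists.

lookup-injective : ∀ {a} {A : Set a} {xs : List A} → Unique xs →
                   ∀ {i j} → lookup xs i ≡ lookup xs j → i ≡ j
lookup-injective (_ ∷ _)  {zero}  {zero}  _  = refl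
lookup-injective (x∉ ∷ _) {zero}  {suc j} eq = contradiction eq (All.lookup x∉ (∈-lookup j))
lookup-injective (x∉ ∷ _) {suc i} {zero}  eq = contradiction (sym eq) (All.lookup x∉ (∈-lookup i))
lookup-injective (_ ∷ u)  {suc i} {suc j} eq = cong suc (lookup-injective u eq)

-- Sending each index of `xs` to the position of its entry in `ys` is injective because `xs` has no
-- repetitions, so the pigeonhole principle applies.
unique-⊆⇒length≤ : ∀ {a} {A : Set a} {xs ys : List A} → Unique xs →
                   (∀ {x} → x ∈ xs → x ∈ ys) → length xs ≤ length ys
unique-⊆⇒length≤ {xs = xs} {ys} u xs⊆ys = injective⇒≤ {f = position} λ {i} {j} eq →
  lookup-injective u
    (trans (lookup-index (xs⊆ys (∈-lookup i)))
    (trans (cong (lookup ys) eq) (sym (lookup-index (xs⊆ys (∈-lookup j))))))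
  where
  position : Fin (length xs) → Fin (length ys)
  position i = Any.index (xs⊆ys (∈-lookup i))

length-concatMap-tabulate : ∀ {a b} {A : Set a} {B : Set b} {n} (f : A → List B) (g : Fin n → A) →
                            length (concatMap f (tabulate g)) ≡ sumℕ (length ∘ f ∘ g)
length-concatMap-tabulate {n = zero}  f g = refl
length-concatMap-tabulate {n = suc n} f g =
  trans (length-++ (f (g zero))) (cong (length (f (g zero)) +_) (length-concatMap-tabulate f (g ∘ suc)))

sumℕ-≤ : ∀ {n} {f : Fin n → ℕ} c → (∀ i → f i ≤ c) → sumℕ f ≤ n * c
sumℕ-≤ {zero}  c f≤c = z≤n
sumℕ-≤ {suc n} c f≤c = ℕ.+-mono-≤ (f≤c zero) (sumℕ-≤ c (f≤c ∘ suc))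

-- Graphs, degrees and the handshake inequality.

T-does⁻ : ∀ {A : Set} (a? : Dec A) → T (does a?) → A
T-does⁻ (yes a) _ = a

T-does⁺ : ∀ {A : Set} (a? : Dec A) → A → T (does a?)
T-does⁺ (yes _) _ = _
T-does⁺ (no ¬a) a = ¬a a

fromRelation : ∀ {n} {R : Rel (Fin n) 0ℓ} → Decidable R → Symmetric R → (∀ v → ¬ R v v) → Graph n
fromRelation R? R-sym R-irrefl = record
  { adj    = λ u v → does (R? u v)
  ; sym    = λ u v → does-⇔ (mk⇔ R-sym R-sym) (R? u v) (R? v u)
  -- `does (no id)` computes to `false`, so it suffices that `R v v` is equivalent to the empty
  -- type.
  ; irrefl = λ v → does-⇔ (mk⇔ (R-irrefl v) ⊥-elim) (R? v v) (no id)
  }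

module _ {n} (G : Graph n) where
  open Graph G hiding (∣E∣)

  ~-sym : ∀ {u v} → u ~ v → v ~ u
  ~-sym {u} {v} = subst T (Graph.sym G u v)

  ~-irrefl : ∀ {v} → ¬ v ~ v
  ~-irrefl {v} = subst T (irrefl v)

  edges-unique : Unique edges
  edges-unique = Unique.filter⁺ _ (Unique.cartesianProduct⁺ (Unique.allFin⁺ n) (Unique.allFin⁺ n))

  ∈-edges⁺ : ∀ {u v} → u Fin.< v → u ~ v → (u , v) ∈ edges
  ∈-edges⁺ {u} {v} u<v u~v =
    ∈-filter⁺ (λ (u , v) → (u <? v) ×-dec T? (adj u v))
      (∈-cartesianProduct⁺ (∈-allFin u) (∈-allFin v)) (u<v , u~v)

  ∈-edges⁻ : ∀ {u v} → (u , v) ∈ edges → u Fin.< v × u ~ v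
  ∈-edges⁻ e = proj₂ (∈-filter⁻ (λ (u , v) → (u <? v) ×-dec T? (adj u v))
    {xs = cartesianProduct (allFin n) (allFin n)} e)

  neighbours : Fin n → List (Fin n)
  neighbours u = filter (λ v → T? (adj u v)) (allFin n)

  degree : Fin n → ℕ
  degree = length ∘ neighbours

  ∈-neighbours⁺ : ∀ {u v} → u ~ v → v ∈ neighbours u
  ∈-neighbours⁺ {u} {v} = ∈-filter⁺ (λ v → T? (adj u v)) (∈-allFin v)

  ∈-neighbours⁻ : ∀ {u v} → v ∈ neighbours u → u ~ v
  ∈-neighbours⁻ {u} = proj₂ ∘ ∈-filter⁻ (λ v → T? (adj u v)) {xs = allFin n}

  neighbours-unique : ∀ u → Unique (neighbours u)
  neighbours-unique u = Unique.filter⁺ _ (Unique.allFin⁺ n)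

  degree-≤ : ∀ {u} vs → (∀ {v} → u ~ v → v ∈ vs) → degree u ≤ length vs
  degree-≤ {u} vs h = unique-⊆⇒length≤ (neighbours-unique u) (h ∘ ∈-neighbours⁻)

  arcs : List (Fin n × Fin n)
  arcs = concatMap (λ u → map (u ,_) (neighbours u)) (allFin n)

  ∈-arcs⁺ : ∀ {u v} → u ~ v → (u , v) ∈ arcs
  ∈-arcs⁺ {u} u~v = ∈-concatMap⁺ _ (lose (∈-allFin u) (∈-map⁺ (u ,_) (∈-neighbours⁺ u~v)))

  length-arcs : length arcs ≡ sumℕ degree
  length-arcs = trans (length-concatMap-tabulate (λ u → map (u ,_) (neighbours u)) id) (go id)
    where
    go : ∀ {k} (g : Fin k → Fin n) →
         sumℕ (λ i → length (map (g i ,_) (neighbours (g i)))) ≡ sumℕ (degree ∘ g)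
    go {zero}  g = refl
    go {suc k} g = cong₂ _+_ (length-map _ (neighbours (g zero))) (go (g ∘ suc))

  -- Edges are listed with increasing endpoints, so their reversals are disjoint from them, and both
  -- orientations occur among the arcs, which number the degree sum. This direction of the handshake
  -- identity turns upper bounds on degrees into upper bounds on `∣E∣ G`.
  2∣E∣≤∑degree : ∣E∣ G + ∣E∣ G ≤ sumℕ degree
  2∣E∣≤∑degree = begin
    length edges + length edges             ≡⟨ cong (length edges +_) (length-map swap edges) ⟨
    length edges + length (map swap edges)  ≡⟨ length-++ edges ⟨
    length (edges ++ map swap edges)        ≤⟨ unique-⊆⇒length≤ both-unique both⊆arcs ⟩
    length arcs                             ≡⟨ length-arcs ⟩
    sumℕ degree                             ∎
    where
    open ℕ.≤-Reasoning
    both-unique : Unique (edges ++ map swap edges)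
    both-unique = Unique.++⁺ edges-unique (Unique.map⁺ (λ { refl → refl }) edges-unique) disjoint
      where
      disjoint : ∀ {e} → ¬ (e ∈ edges × e ∈ map swap edges)
      disjoint (e∈ , e∈′) with (v , u) , e∈″ , refl ← ∈-map⁻ swap e∈′ =
        <-asym (proj₁ (∈-edges⁻ e∈)) (proj₁ (∈-edges⁻ e∈″))
    both⊆arcs : ∀ {e} → e ∈ edges ++ map swap edges → e ∈ arcs
    both⊆arcs e∈ with ∈-++⁻ edges e∈
    ... | inj₁ e∈′ = ∈-arcs⁺ (proj₂ (∈-edges⁻ e∈′))
    ... | inj₂ e∈′ with (v , u) , e∈″ , refl ← ∈-map⁻ swap e∈′ = ∈-arcs⁺ (~-sym (proj₂ (∈-edges⁻ e∈″)))

-- One-extendability as a condition on single edges.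

EveryEdgeInPerfectMatching : ∀ {n} → Graph n → Set
EveryEdgeInPerfectMatching G =
  ∀ {u v} → Graph._~_ G u v → ∃[ P ] IsPerfectMatching G P × Graph._~_ P u v

module _ {n} {u v : Fin n} (u<v : u Fin.< v) where
  SingleEdge : Rel (Fin n) 0ℓ
  SingleEdge a b = (a ≡ u × b ≡ v) ⊎ (a ≡ v × b ≡ u)

  singleEdge? : Decidable SingleEdge
  singleEdge? a b = ((a ≟ u) ×-dec (b ≟ v)) ⊎-dec ((a ≟ v) ×-dec (b ≟ u))

  singleEdge : Graph n
  singleEdge = fromRelation singleEdge?
    (λ { (inj₁ (p , q)) → inj₂ (q , p) ; (inj₂ (p , q)) → inj₁ (q , p) })
    (λ { a (inj₁ (refl , refl)) → <-irrefl refl u<v ; a (inj₂ (refl , refl)) → <-irrefl refl u<v })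

  u~v-singleEdge : Graph._~_ singleEdge u v
  u~v-singleEdge = T-does⁺ (singleEdge? u v) (inj₁ (refl , refl))

  ∣E∣-singleEdge : ∣E∣ singleEdge ≡ 1
  ∣E∣-singleEdge = ℕ.≤-antisym
    (unique-⊆⇒length≤ {ys = [ u , v ]} (edges-unique singleEdge) only-uv)
    (unique-⊆⇒length≤ ([] ∷ []) λ { (here refl) → ∈-edges⁺ singleEdge u<v u~v-singleEdge })
    where
    only-uv : ∀ {e} → e ∈ Graph.edges singleEdge → e ∈ [ u , v ]
    only-uv {a , b} e∈ with ∈-edges⁻ singleEdge e∈
    ... | a<b , a~b with T-does⁻ (singleEdge? a b) a~b
    ...   | inj₁ (refl , refl) = here refl
    ...   | inj₂ (refl , refl) = contradiction u<v (<-asym a<b)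

  singleEdge-isMatching : ∀ {G} → Graph._~_ G u v → IsMatching G singleEdge
  singleEdge-isMatching {G} u~v = record
    { subset   = λ a b a~b → subset′ (T-does⁻ (singleEdge? a b) a~b)
    ; disjoint = λ a b c a~b a~c → disjoint′ (T-does⁻ (singleEdge? a b) a~b) (T-does⁻ (singleEdge? a c) a~c)
    }
    where
    subset′ : ∀ {a b} → SingleEdge a b → Graph._~_ G a b
    subset′ (inj₁ (refl , refl)) = u~v
    subset′ (inj₂ (refl , refl)) = ~-sym G u~v
    disjoint′ : ∀ {a b c} → SingleEdge a b → SingleEdge a c → b ≡ c
    disjoint′ (inj₁ (_ , refl))    (inj₁ (_ , refl))    = refl
    disjoint′ (inj₂ (_ , refl))    (inj₂ (_ , refl))    = refl
    disjoint′ (inj₁ (refl , _))    (inj₂ (refl , _))    = contradiction u<v (<-irrefl refl)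
    disjoint′ (inj₂ (refl , _))    (inj₁ (refl , _))    = contradiction u<v (<-irrefl refl)

-- The edge alone is a matching of size 1. Comparing `u` with `v` orients it, since `singleEdge` is
-- built from an increasing pair.
extendable₁⇒edgeInPM : ∀ {n} {G : Graph n} → Extendable 1 G → EveryEdgeInPerfectMatching G
extendable₁⇒edgeInPM {G = G} ext {u} {v} u~v with <-cmp u v
... | tri≈ _ refl _ = contradiction u~v (~-irrefl G)
... | tri< u<v _ _ =
  let P , pm , M⊆P = Extendable.extends ext (singleEdge u<v) (singleEdge-isMatching u<v {G} u~v)
                                            (∣E∣-singleEdge u<v)
  in P , pm , M⊆P u v (u~v-singleEdge u<v)
... | tri> _ _ v<u =
  let P , pm , M⊆P = Extendable.extends ext (singleEdge v<u) (singleEdge-isMatching v<u {G} (~-sym G u~v))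
                                            (∣E∣-singleEdge v<u)
  in P , pm , ~-sym P (M⊆P v u (u~v-singleEdge v<u))

-- A matching whose only edge is `ab` lies in any perfect matching that contains `ab`. The given
-- edge `uv` supplies the matching of size 1 that extendability asks for.
edgeInPM⇒extendable₁ : ∀ {n} {G : Graph n} → 4 ≤ n → Connected G → ∀ {u v} → Graph._~_ G u v →
                       EveryEdgeInPerfectMatching G → Extendable 1 G
edgeInPM⇒extendable₁ {n} {G} 4≤n conn {u} {v} u~v inPM = record
  { connected = conn
  ; bound     = 4≤n
  ; matching  = single
  ; extends   = extends
  }
  where
  single : ∃[ M ] IsMatching G M × ∣E∣ M ≡ 1
  single with <-cmp u v
  ... | tri≈ _ refl _ = contradiction u~v (~-irrefl G)
  ... | tri< u<v _ _  = singleEdge u<v , singleEdge-isMatching u<v {G} u~v , ∣E∣-singleEdge u<v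
  ... | tri> _ _ v<u  = singleEdge v<u , singleEdge-isMatching v<u {G} (~-sym G u~v) , ∣E∣-singleEdge v<u

  extends : ∀ M → IsMatching G M → ∣E∣ M ≡ 1 → ∃[ P ] IsPerfectMatching G P × M ⊆ P
  extends M isM ∣M∣≡1 = go (Graph.edges M) refl ∣M∣≡1
    where
    -- The edge list of `M` is generalised to a variable so that its length can be matched on, which
    -- leaves a single pair.
    go : ∀ es → Graph.edges M ≡ es → length es ≡ 1 → ∃[ P ] IsPerfectMatching G P × M ⊆ P
    go ((a , b) ∷ []) eq _ with ∈-edges⁻ M (subst ((a , b) ∈_) (sym eq) (here refl))
    ... | _ , a~b with inPM (IsMatching.subset isM a b a~b)
    ...   | P , pm , a~ₚb = P , pm , M⊆P
      where
      ordered : ∀ {x y} → x Fin.< y → Graph._~_ M x y → Graph._~_ P x y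
      ordered x<y x~y with here refl ← subst (_ ∈_) eq (∈-edges⁺ M x<y x~y) = a~ₚb
      M⊆P : M ⊆ P
      M⊆P x y x~y with <-cmp x y
      ... | tri< x<y _ _  = ordered x<y x~y
      ... | tri≈ _ refl _ = contradiction x~y (~-irrefl M)
      ... | tri> _ _ y<x  = ~-sym P (ordered y<x (~-sym M x~y))

-- Integer linear forms and homogeneous systems.

Linear : ∀ {k} → ((Fin k → ℤ) → ℤ) → Set
Linear f = ∀ {x y z} a b → (∀ i → z i ≡ a ℤ.* x i ℤ.+ b ℤ.* y i) → f z ≡ a ℤ.* f x ℤ.+ b ℤ.* f y

-- A form is a function with a proof of linearity rather than a coefficient vector: elimination only
-- evaluates forms at combinations and restricts them. `Linear` takes the combination as a vector
-- `z` given pointwise, so that functions are compared only entry by entry.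
record LinearForm (k : ℕ) : Set where
  field
    apply  : (Fin k → ℤ) → ℤ
    linear : Linear apply

open LinearForm

coordinate : ∀ {k} → Fin k → LinearForm k
coordinate i = record { apply = λ x → x i ; linear = λ _ _ eq → eq i }

infixl 6 _⊕_
_⊕_ : ∀ {k} → LinearForm k → LinearForm k → LinearForm k
f ⊕ g = record
  { apply  = λ x → apply f x ℤ.+ apply g x
  ; linear = λ {x} {y} a b eq →
      trans (cong₂ ℤ._+_ (linear f a b eq) (linear g a b eq))
            (rearrange a b (apply f x) (apply f y) (apply g x) (apply g y))
  }
  where
  rearrange : ∀ a b p q r s → (a ℤ.* p ℤ.+ b ℤ.* q) ℤ.+ (a ℤ.* r ℤ.+ b ℤ.* s) ≡
                              a ℤ.* (p ℤ.+ r) ℤ.+ b ℤ.* (q ℤ.+ s)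
  rearrange = ℤ-Solver.solve-∀

scale : ∀ {k} → LinearForm k → ℤ → LinearForm k
scale f c = record
  { apply  = λ x → apply f x ℤ.* c
  ; linear = λ {x} {y} a b eq →
      trans (cong (ℤ._* c) (linear f a b eq)) (rearrange a b c (apply f x) (apply f y))
  }
  where
  rearrange : ∀ a b c p q → (a ℤ.* p ℤ.+ b ℤ.* q) ℤ.* c ≡ a ℤ.* (p ℤ.* c) ℤ.+ b ℤ.* (q ℤ.* c)
  rearrange = ℤ-Solver.solve-∀

sumForm : ∀ {k d} → (Fin d → LinearForm k) → LinearForm k
sumForm {k} fs = record { apply = λ x → sum (λ i → apply (fs i) x) ; linear = linear-sum fs }
  where
  linear-sum : ∀ {d} (fs : Fin d → LinearForm k) → Linear (λ x → sum (λ i → apply (fs i) x))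
  linear-sum {zero}  fs a b _ = sym (cong₂ ℤ._+_ (ℤ.*-zeroʳ a) (ℤ.*-zeroʳ b))
  linear-sum {suc d} fs = linear
    (fs zero ⊕ record { apply = λ x → sum (λ i → apply (fs (suc i)) x) ; linear = linear-sum (fs ∘ suc) })

-- The coordinate hyperplane of index `p` is identified with the vectors having one entry fewer;
-- this is how elimination drops a variable.
restrict : ∀ {k} → Fin (suc k) → LinearForm (suc k) → LinearForm k
restrict p f = record
  { apply  = λ x → apply f (insertAt x p 0ℤ)
  ; linear = λ {x} {y} {z} a b eq → linear f a b (linear-insertAt p x y z a b eq)
  }
  where
  linear-insertAt : ∀ {k} p (x y z : Fin k → ℤ) a b → (∀ i → z i ≡ a ℤ.* x i ℤ.+ b ℤ.* y i) →
                    ∀ i → insertAt z p 0ℤ i ≡ a ℤ.* insertAt x p 0ℤ i ℤ.+ b ℤ.* insertAt y p 0ℤ i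
  linear-insertAt         zero    x y z a b eq zero    = sym (cong₂ ℤ._+_ (ℤ.*-zeroʳ a) (ℤ.*-zeroʳ b))
  linear-insertAt         zero    x y z a b eq (suc i) = eq i
  linear-insertAt {suc k} (suc p) x y z a b eq zero    = eq zero
  linear-insertAt {suc k} (suc p) x y z a b eq (suc i) =
    linear-insertAt p (x ∘ suc) (y ∘ suc) (z ∘ suc) a b (eq ∘ suc) i

*-≢0 : ∀ {a b} → a ≢ 0ℤ → b ≢ 0ℤ → a ℤ.* b ≢ 0ℤ
*-≢0 {a} a≢0 b≢0 ab≡0 with ℤ.i*j≡0⇒i≡0∨j≡0 a ab≡0
... | inj₁ a≡0 = a≢0 a≡0
... | inj₂ b≡0 = b≢0 b≡0

-- To add the form f, take a solution x of the other forms with x p ≢ 0 and a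
-- solution y of them on the hyperplane of index p; then f y · x − f x · y is
-- killed by f, and its p-th entry is nonzero unless f y = 0.
nontrivialZero : ∀ {k} (fs : List (LinearForm k)) → length fs < k →
                 ∃[ x ] (∃[ i ] x i ≢ 0ℤ) × All (λ f → apply f x ≡ 0ℤ) fs
nontrivialZero {suc k}       []       _        = (λ _ → 1ℤ) , (zero , λ ()) , []
nontrivialZero {suc k} (f ∷ fs) (s≤s lt)
  with nontrivialZero fs (ℕ.m<n⇒m<1+n lt)
... | x , (p , xp≢0) , fsx≡0
  with nontrivialZero (map (restrict p) fs) (subst (_< k) (sym (length-map (restrict p) fs)) lt)
... | y′ , (q , y′q≢0) , fsy′≡0 = combine (apply f y ℤ.≟ 0ℤ)
  where
  y z : Fin (suc k) → ℤ
  y = insertAt y′ p 0ℤ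
  z i = apply f y ℤ.* x i ℤ.+ (ℤ.- apply f x) ℤ.* y i

  fsy≡0 : All (λ g → apply g y ≡ 0ℤ) fs
  fsy≡0 = All.map⁻ fsy′≡0

  cancel : ∀ a b → a ℤ.* b ℤ.+ (ℤ.- b) ℤ.* a ≡ 0ℤ
  cancel = ℤ-Solver.solve-∀

  drop-zero : ∀ a b → a ℤ.+ b ℤ.* 0ℤ ≡ a
  drop-zero = ℤ-Solver.solve-∀

  combination-of-zeros : ∀ a b → a ℤ.* 0ℤ ℤ.+ b ℤ.* 0ℤ ≡ 0ℤ
  combination-of-zeros = ℤ-Solver.solve-∀

  zp : z p ≡ apply f y ℤ.* x p
  zp = trans (cong (λ t → apply f y ℤ.* x p ℤ.+ (ℤ.- apply f x) ℤ.* t) (insertAt-lookup y′ p 0ℤ))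
             (drop-zero _ (ℤ.- apply f x))

  gz≡0 : ∀ {g} → apply g x ≡ 0ℤ × apply g y ≡ 0ℤ → apply g z ≡ 0ℤ
  gz≡0 {g} (gx≡0 , gy≡0) = begin
    apply g z
      ≡⟨ linear g (apply f y) (ℤ.- apply f x) (λ _ → refl) ⟩
    apply f y ℤ.* apply g x ℤ.+ (ℤ.- apply f x) ℤ.* apply g y
      ≡⟨ cong₂ (λ s t → apply f y ℤ.* s ℤ.+ (ℤ.- apply f x) ℤ.* t) gx≡0 gy≡0 ⟩
    apply f y ℤ.* 0ℤ ℤ.+ (ℤ.- apply f x) ℤ.* 0ℤ
      ≡⟨ combination-of-zeros (apply f y) (ℤ.- apply f x) ⟩
    0ℤ ∎
    where open ≡-Reasoning

  combine : Dec (apply f y ≡ 0ℤ) → ∃[ w ] (∃[ i ] w i ≢ 0ℤ) × All (λ g → apply g w ≡ 0ℤ) (f ∷ fs)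
  combine (yes fy≡0) =
    y , (punchIn p q , y′q≢0 ∘ trans (sym (insertAt-punchIn y′ p 0ℤ q))) , fy≡0 ∷ fsy≡0
  combine (no fy≢0) =
    z , (p , *-≢0 fy≢0 xp≢0 ∘ trans (sym zp)) ,
    trans (linear f (apply f y) (ℤ.- apply f x) (λ _ → refl)) (cancel (apply f y) (apply f x)) ∷
    All.zipWith (λ {g} → gz≡0 {g}) (fsx≡0 , fsy≡0)

-- Sums of integers and an orthogonality argument.

sum-zero : ∀ {n} {f : Fin n → ℤ} → (∀ i → f i ≡ 0ℤ) → sum f ≡ 0ℤ
sum-zero {n} f≡0 = trans (sum-cong-≗ f≡0) (sum-replicate-zero n)

sum-only : ∀ {n} (f : Fin n → ℤ) j → (∀ i → i ≢ j → f i ≡ 0ℤ) → sum f ≡ f j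
sum-only {suc n} f j f≡0 = begin
  sum f                       ≡⟨ sum-remove {i = j} f ⟩
  f j ℤ.+ sum (removeAt f j)  ≡⟨ cong (λ s → f j ℤ.+ s) (sum-zero λ i → f≡0 (punchIn j i) (punchInᵢ≢i j i)) ⟩
  f j ℤ.+ 0ℤ                  ≡⟨ ℤ.+-identityʳ (f j) ⟩
  f j                         ∎
  where open ≡-Reasoning

sum-nonneg : ∀ {n} {f : Fin n → ℤ} → (∀ i → 0ℤ ℤ.≤ f i) → 0ℤ ℤ.≤ sum f
sum-nonneg {zero}  _   = ℤ.≤-refl
sum-nonneg {suc n} 0≤f = ℤ.+-mono-≤ (0≤f zero) (sum-nonneg (0≤f ∘ suc))

nonneg-+≡0 : ∀ {a b} → 0ℤ ℤ.≤ a → 0ℤ ℤ.≤ b → a ℤ.+ b ≡ 0ℤ → a ≡ 0ℤ × b ≡ 0ℤ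
nonneg-+≡0 {ℤ.+ zero} {ℤ.+ zero} _ _ _ = refl , refl

sum-nonneg≡0 : ∀ {n} {f : Fin n → ℤ} → (∀ i → 0ℤ ℤ.≤ f i) → sum f ≡ 0ℤ → ∀ i → f i ≡ 0ℤ
sum-nonneg≡0 0≤f ∑≡0 zero    = proj₁ (nonneg-+≡0 (0≤f zero) (sum-nonneg (0≤f ∘ suc)) ∑≡0)
sum-nonneg≡0 0≤f ∑≡0 (suc i) =
  sum-nonneg≡0 (0≤f ∘ suc) (proj₂ (nonneg-+≡0 (0≤f zero) (sum-nonneg (0≤f ∘ suc)) ∑≡0)) i

0≤square : ∀ a → 0ℤ ℤ.≤ a ℤ.* a
0≤square (ℤ.+ zero)    = ℤ.+≤+ z≤n
0≤square +[1+ n ]      = ℤ.+≤+ z≤n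
0≤square -[1+ n ]      = ℤ.+≤+ z≤n

square≡0 : ∀ {a} → a ℤ.* a ≡ 0ℤ → a ≡ 0ℤ
square≡0 {a} aa≡0 = [ id , id ]′ (ℤ.i*j≡0⇒i≡0∨j≡0 a aa≡0)

-- The matrix (y u + y v) is orthogonal to z, so the hypothesis says that z is
-- orthogonal to itself.
orthogonal⇒zero : ∀ {n} (y : Fin n → ℤ) (z : Fin n → Fin n → ℤ) →
                  (∀ u v → z u v ≡ z v u) → (∀ u → sum (z u) ≡ 0ℤ) →
                  (∀ u v → (y u ℤ.+ y v ℤ.+ z u v) ℤ.* z u v ≡ 0ℤ) →
                  ∀ u v → z u v ≡ 0ℤ
orthogonal⇒zero {n} y z z-sym rows≡0 orth u v = square≡0
  (sum-nonneg≡0 (λ v → 0≤square (z u v)) (sum-nonneg≡0 (λ u → sum-nonneg (λ v → 0≤square (z u v))) ∑∑zz≡0 u) v)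
  where
  open ≡-Reasoning
  ∑∑ : (Fin n → Fin n → ℤ) → ℤ
  ∑∑ f = sum (λ u → sum (f u))

  ∑∑-cong : ∀ {f g} → (∀ u v → f u v ≡ g u v) → ∑∑ f ≡ ∑∑ g
  ∑∑-cong eq = sum-cong-≗ λ u → sum-cong-≗ (eq u)

  ∑∑-+ : ∀ f g → ∑∑ (λ u v → f u v ℤ.+ g u v) ≡ ∑∑ f ℤ.+ ∑∑ g
  ∑∑-+ f g = trans (sum-cong-≗ λ u → ∑-distrib-+ (f u) (g u)) (∑-distrib-+ (λ u → sum (f u)) (λ u → sum (g u)))

  ∑∑yᵤz≡0 : ∑∑ (λ u v → y u ℤ.* z u v) ≡ 0ℤ
  ∑∑yᵤz≡0 = sum-zero λ u → begin
    sum (λ v → y u ℤ.* z u v)  ≡⟨ *-distribˡ-sum (y u) (z u) ⟨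
    y u ℤ.* sum (z u)          ≡⟨ cong (y u ℤ.*_) (rows≡0 u) ⟩
    y u ℤ.* 0ℤ                 ≡⟨ ℤ.*-zeroʳ (y u) ⟩
    0ℤ                         ∎

  ∑∑yᵥz≡0 : ∑∑ (λ u v → y v ℤ.* z u v) ≡ 0ℤ
  ∑∑yᵥz≡0 = begin
    ∑∑ (λ u v → y v ℤ.* z u v)  ≡⟨ ∑-comm (λ u v → y v ℤ.* z u v) ⟩
    ∑∑ (λ v u → y v ℤ.* z u v)  ≡⟨ ∑∑-cong (λ v u → cong (y v ℤ.*_) (z-sym u v)) ⟩
    ∑∑ (λ v u → y v ℤ.* z v u)  ≡⟨ ∑∑yᵤz≡0 ⟩
    0ℤ                          ∎

  expand : ∀ a b c → (a ℤ.+ b ℤ.+ c) ℤ.* c ≡ a ℤ.* c ℤ.+ b ℤ.* c ℤ.+ c ℤ.* c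
  expand = ℤ-Solver.solve-∀

  ∑∑zz≡0 : ∑∑ (λ u v → z u v ℤ.* z u v) ≡ 0ℤ
  ∑∑zz≡0 = begin
    ∑∑ (λ u v → z u v ℤ.* z u v)
      ≡⟨ ℤ.+-identityˡ _ ⟨
    0ℤ ℤ.+ 0ℤ ℤ.+ ∑∑ (λ u v → z u v ℤ.* z u v)
      ≡⟨ cong₂ (λ s t → s ℤ.+ t ℤ.+ ∑∑ (λ u v → z u v ℤ.* z u v)) ∑∑yᵤz≡0 ∑∑yᵥz≡0 ⟨
    ∑∑ (λ u v → y u ℤ.* z u v) ℤ.+ ∑∑ (λ u v → y v ℤ.* z u v) ℤ.+ ∑∑ (λ u v → z u v ℤ.* z u v)
      ≡⟨ cong (ℤ._+ ∑∑ (λ u v → z u v ℤ.* z u v)) (∑∑-+ (λ u v → y u ℤ.* z u v) (λ u v → y v ℤ.* z u v)) ⟨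
    ∑∑ (λ u v → y u ℤ.* z u v ℤ.+ y v ℤ.* z u v) ℤ.+ ∑∑ (λ u v → z u v ℤ.* z u v)
      ≡⟨ ∑∑-+ (λ u v → y u ℤ.* z u v ℤ.+ y v ℤ.* z u v) (λ u v → z u v ℤ.* z u v) ⟨
    ∑∑ (λ u v → y u ℤ.* z u v ℤ.+ y v ℤ.* z u v ℤ.+ z u v ℤ.* z u v)
      ≡⟨ ∑∑-cong (λ u v → expand (y u) (y v) (z u v)) ⟨
    ∑∑ (λ u v → (y u ℤ.+ y v ℤ.+ z u v) ℤ.* z u v)
      ≡⟨ sum-zero (λ u → sum-zero (orth u)) ⟩
    0ℤ ∎

-- Sign patterns and bipartiteness.

positive : ℤ → Bool
positive +[1+ _ ] = true
positive _        = false

positive-neg : ∀ {a} → a ≢ 0ℤ → positive a ≢ positive (ℤ.- a)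
positive-neg {ℤ.+ zero} a≢0 _  = a≢0 refl
positive-neg {+[1+ _ ]}   _   ()
positive-neg { -[1+ _ ]}  _   ()

-- Along an edge `y` changes sign, so one nonzero value makes `y` nonzero on the whole connected
-- graph, and then its sign is a proper 2-colouring. `positive` puts 0 with the negatives, which is
-- harmless once every value is nonzero.
alternating⇒zero : ∀ {n} {G : Graph n} → Connected G → ¬ Bipartite G → (y : Fin n → ℤ) →
                   (∀ {u v} → Graph._~_ G u v → y u ℤ.+ y v ≡ 0ℤ) → ∀ u → y u ≡ 0ℤ
alternating⇒zero {G = G} conn ¬bip y y-alt u = decidable-stable (y u ℤ.≟ 0ℤ) λ yu≢0 →
  ¬bip (positive ∘ y , λ v w v~w →
    subst (λ t → positive (y v) ≢ positive t) (sym (neg v~w)) (positive-neg (nonzero yu≢0 (conn u v))))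
  where
  open Graph G using (_~_)
  neg : ∀ {v w} → v ~ w → y w ≡ ℤ.- y v
  neg v~w = inverseʳ-unique (AbelianGroup.group ℤ.+-0-abelianGroup) _ _ (y-alt v~w)
  nonzero : ∀ {v w} → y v ≢ 0ℤ → Star _~_ v w → y w ≢ 0ℤ
  nonzero yv≢0 ε = yv≢0
  nonzero yv≢0 (v~w ◅ p) = nonzero (λ yw≡0 → yv≢0 (ℤ.neg-injective (trans (sym (neg v~w)) yw≡0))) p

indicator : Bool → ℤ
indicator b = if b then 1ℤ else 0ℤ

indicator-true : ∀ {b} → T b → indicator b ≡ 1ℤ
indicator-true {true} _ = refl

indicator-false : ∀ {b} → ¬ T b → indicator b ≡ 0ℤ
indicator-false {true}  ¬b = contradiction _ ¬b
indicator-false {false} _  = refl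

-- The bound on the degree of a vertex `w`.

module DegreeBound {n} (G : Graph n) (conn : Connected G) (¬bip : ¬ Bipartite G)
                   (inPM : EveryEdgeInPerfectMatching G) (w : Fin n) where
  open Graph G using (_~_; adj; edges)

  d : ℕ
  d = degree G w

  nbr : Fin d → Fin n
  nbr = lookup (neighbours G w)

  w~nbr : ∀ i → w ~ nbr i
  w~nbr i = ∈-neighbours⁻ G (∈-lookup {xs = neighbours G w} i)

  P : Fin d → Graph n
  P i = proj₁ (inPM (w~nbr i))

  P-pm : ∀ i → IsPerfectMatching G (P i)
  P-pm i = proj₁ (proj₂ (inPM (w~nbr i)))

  P∋ : ∀ i → Graph._~_ (P i) w (nbr i)
  P∋ i = proj₂ (proj₂ (inPM (w~nbr i)))

  P-disjoint : ∀ i {u v v′} → Graph._~_ (P i) u v → Graph._~_ (P i) u v′ → v ≡ v′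
  P-disjoint i = IsMatching.disjoint (IsPerfectMatching.isMatching (P-pm i)) _ _ _

  χ : Fin d → Fin n → Fin n → ℤ
  χ i u v = indicator (Graph.adj (P i) u v)

  -- `u` has exactly one partner in `P i`, so its row of the adjacency matrix has a single entry 1.
  χ-row : ∀ i u → sum (χ i u) ≡ 1ℤ
  χ-row i u with v , u~v ← IsPerfectMatching.covers (P-pm i) u =
    trans (sum-only (χ i u) v λ v′ v′≢v → indicator-false (v′≢v ∘ λ u~v′ → P-disjoint i u~v′ u~v))
          (indicator-true u~v)

  χ-off : ∀ i {u v} → ¬ u ~ v → χ i u v ≡ 0ℤ
  χ-off i u≁v = indicator-false (u≁v ∘ IsMatching.subset (IsPerfectMatching.isMatching (P-pm i)) _ _)

  -- `P i` already matches `w` to `nbr i`, and distinct indices give distinct neighbours. Hence the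
  -- rows `w` of the matrices `χ i` are independent, which later isolates each coefficient.
  χ-w : ∀ {i j} → i ≢ j → χ i w (nbr j) ≡ 0ℤ
  χ-w {i} {j} i≢j = indicator-false λ w~ → i≢j
    (lookup-injective (neighbours-unique G w) (P-disjoint i (P∋ i) w~))

  -- A vector of unknowns holds the vertex weights `y` in its first `n` entries and the matching
  -- coefficients `c` in the last `d`.
  vertexForm : Fin n → LinearForm (n + d)
  vertexForm u = coordinate (u ↑ˡ d)

  matchingForm : Fin d → LinearForm (n + d)
  matchingForm i = coordinate (n ↑ʳ i)

  edgeForm : Fin n × Fin n → LinearForm (n + d)
  edgeForm (u , v) = vertexForm u ⊕ vertexForm v ⊕ sumForm (λ i → scale (matchingForm i) (χ i u v))

  forms : List (LinearForm (n + d))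
  forms = sumForm matchingForm ∷ map edgeForm edges

  module _ (x : Fin (n + d) → ℤ) (forms≡0 : All (λ f → apply f x ≡ 0ℤ) forms) where
    y : Fin n → ℤ
    y u = x (u ↑ˡ d)

    c : Fin d → ℤ
    c i = x (n ↑ʳ i)

    z : Fin n → Fin n → ℤ
    z u v = sum (λ i → c i ℤ.* χ i u v)

    ∑c≡0 : sum c ≡ 0ℤ
    ∑c≡0 = All.head forms≡0

    z-sym : ∀ u v → z u v ≡ z v u
    z-sym u v = sum-cong-≗ λ i → cong (λ b → c i ℤ.* indicator b) (Graph.sym (P i) u v)

    -- Each perfect matching contributes its coefficient once to every row, so the row sum is the
    -- sum of the coefficients, which the first form makes zero.
    z-rows : ∀ u → sum (z u) ≡ 0ℤ
    z-rows u = begin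
      sum (λ v → sum (λ i → c i ℤ.* χ i u v))  ≡⟨ ∑-comm (λ v i → c i ℤ.* χ i u v) ⟩
      sum (λ i → sum (λ v → c i ℤ.* χ i u v))  ≡⟨ sum-cong-≗ (λ i → *-distribˡ-sum (c i) (χ i u)) ⟨
      sum (λ i → c i ℤ.* sum (χ i u))          ≡⟨ sum-cong-≗ (λ i → cong (c i ℤ.*_) (χ-row i u)) ⟩
      sum (λ i → c i ℤ.* 1ℤ)                   ≡⟨ sum-cong-≗ (λ i → ℤ.*-identityʳ (c i)) ⟩
      sum c                                    ≡⟨ ∑c≡0 ⟩
      0ℤ                                       ∎
      where open ≡-Reasoning

    -- A form exists only for the increasing orientation of each edge; the expression is symmetric
    -- in `u` and `v`, which settles the other one.
    edge-equation : ∀ {u v} → u ~ v → y u ℤ.+ y v ℤ.+ z u v ≡ 0ℤ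
    edge-equation {u} {v} u~v with <-cmp u v
    ... | tri< u<v _ _  = All.lookup (All.map⁻ (All.tail forms≡0)) (∈-edges⁺ G u<v u~v)
    ... | tri≈ _ refl _ = contradiction u~v (~-irrefl G)
    ... | tri> _ _ v<u  =
      trans (cong₂ ℤ._+_ (ℤ.+-comm (y u) (y v)) (z-sym u v))
            (All.lookup (All.map⁻ (All.tail forms≡0)) (∈-edges⁺ G v<u (~-sym G u~v)))

    -- On an edge the first factor vanishes; off the edges the second does, because every `P i` is a
    -- subgraph of `G`.
    orth : ∀ u v → (y u ℤ.+ y v ℤ.+ z u v) ℤ.* z u v ≡ 0ℤ
    orth u v with T? (adj u v)
    ... | yes u~v = cong (ℤ._* z u v) (edge-equation u~v)
    ... | no  u≁v = trans (cong ((y u ℤ.+ y v ℤ.+ z u v) ℤ.*_) z≡0) (ℤ.*-zeroʳ (y u ℤ.+ y v ℤ.+ z u v))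
      where
      z≡0 : z u v ≡ 0ℤ
      z≡0 = sum-zero λ i → trans (cong (c i ℤ.*_) (χ-off i u≁v)) (ℤ.*-zeroʳ (c i))

    z≡0 : ∀ u v → z u v ≡ 0ℤ
    z≡0 = orthogonal⇒zero y z z-sym z-rows orth

    -- In the entry of `z` at `w` and `nbr j` only the term of `P j` survives, so this entry equals
    -- `c j`.
    c≡0 : ∀ j → c j ≡ 0ℤ
    c≡0 j = begin
      c j                    ≡⟨ ℤ.*-identityʳ (c j) ⟨
      c j ℤ.* 1ℤ             ≡⟨ cong (c j ℤ.*_) (indicator-true (P∋ j)) ⟨
      c j ℤ.* χ j w (nbr j)  ≡⟨ sum-only (λ i → c i ℤ.* χ i w (nbr j)) j
                                  (λ i i≢j → trans (cong (c i ℤ.*_) (χ-w i≢j)) (ℤ.*-zeroʳ (c i))) ⟨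
      z w (nbr j)            ≡⟨ z≡0 w (nbr j) ⟩
      0ℤ                     ∎
      where open ≡-Reasoning

    -- With `z` zero, each edge equation reduces to `y u + y v = 0`.
    y≡0 : ∀ u → y u ≡ 0ℤ
    y≡0 = alternating⇒zero {G = G} conn ¬bip y λ {u} {v} u~v → begin
      y u ℤ.+ y v             ≡⟨ ℤ.+-identityʳ _ ⟨
      y u ℤ.+ y v ℤ.+ 0ℤ      ≡⟨ cong (λ t → y u ℤ.+ y v ℤ.+ t) (z≡0 u v) ⟨
      y u ℤ.+ y v ℤ.+ z u v   ≡⟨ edge-equation u~v ⟩
      0ℤ                      ∎
      where open ≡-Reasoning

    x≡0 : ∀ k → x k ≡ 0ℤ
    x≡0 k = subst (λ k → x k ≡ 0ℤ) (join-splitAt n d k) (split (splitAt n k))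
      where
      split : ∀ s → x (join n d s) ≡ 0ℤ
      split (inj₁ u) = y≡0 u
      split (inj₂ i) = c≡0 i

  n+degree≤1+∣E∣ : n + d ≤ suc (∣E∣ G)
  -- Fewer forms than unknowns would give a nonzero common zero. The 1 in the bound counts the form
  -- `sumForm matchingForm`.
  n+degree≤1+∣E∣ = ℕ.≮⇒≥ λ lt →
    let x , (k , xk≢0) , forms≡0 = nontrivialZero forms
          (subst (_< n + d) (cong suc (sym (length-map edgeForm edges))) lt)
    in xk≢0 (x≡0 x forms≡0 k)

-- The lower bound on the number of edges.

open DegreeBound using (n+degree≤1+∣E∣)

-- The degree bound is used repeatedly, with `m` the number of edges. If `m < n + 2`, all degrees
-- are at most 2, hence `m ≤ n`; then all degrees are at most 1, hence `2m ≤ n`. Together with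
-- `n ≤ m + 1` this gives `n ≤ 2`, against `4 ≤ n`.
ν+2≤∣E∣ : ∀ {n} {G : Graph n} → 4 ≤ n → Connected G → ¬ Bipartite G → EveryEdgeInPerfectMatching G →
          n + 2 ≤ ∣E∣ G
ν+2≤∣E∣ {n@(suc _)} {G} 4≤n conn ¬bip inPM = ℕ.≮⇒≥ λ m<n+2 →
  let 2m≤2n = degrees≤ 2 m<n+2
      m≤n   = ℕ.*-cancelʳ-≤ m n 2 (subst (_≤ n * 2) (m+m≡m*2 m) 2m≤2n)
      2m≤n  = subst (m + m ≤_) (ℕ.*-identityʳ n) (degrees≤ 1 (subst (suc m ≤_) (ℕ.+-comm 1 n) (s≤s m≤n)))
      -- The degree is dropped from the bound at some vertex; matching `n` as a successor provides
      -- `zero`.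
      n≤1+m = ℕ.m+n≤o⇒m≤o n (n+degree≤1+∣E∣ G conn ¬bip inPM zero)
      2n≤2+n = ℕ.≤-trans (ℕ.+-mono-≤ n≤1+m n≤1+m) (subst (_≤ 2 + n) (cong suc (sym (ℕ.+-suc m m))) (s≤s (s≤s 2m≤n)))
  in ℕ.<⇒≱ (s≤s (s≤s (s≤s z≤n))) (ℕ.≤-trans 4≤n (ℕ.+-cancelʳ-≤ n n 2 2n≤2+n))
  where
  m = ∣E∣ G
  m+m≡m*2 : ∀ m → m + m ≡ m * 2
  m+m≡m*2 = ℕ-Solver.solve-∀
  degrees≤ : ∀ c → suc m ≤ n + c → m + m ≤ n * c
  degrees≤ c 1+m≤n+c = ℕ.≤-trans (2∣E∣≤∑degree G) (sumℕ-≤ c λ w →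
    ℕ.+-cancelˡ-≤ n _ _ (ℕ.≤-trans (n+degree≤1+∣E∣ G conn ¬bip inPM w) 1+m≤n+c))

-- The extremal graphs, as unions of three perfect matchings.

module Involution {n} (σ : Fin n → Fin n) (σ-involutive : ∀ u → σ (σ u) ≡ u) (σ-fpf : ∀ u → σ u ≢ u) where
  σ-sym : Symmetric (λ u v → σ u ≡ v)
  σ-sym {u} refl = σ-involutive u

  graph : Graph n
  graph = fromRelation (λ u v → σ u ≟ v) σ-sym σ-fpf

  -- `σ` sends each vertex to its partner: being single-valued makes the edges disjoint, and being
  -- total makes them cover every vertex.
  isPerfectMatching : ∀ {G : Graph n} → (∀ {u v} → σ u ≡ v → Graph._~_ G u v) → IsPerfectMatching G graph
  isPerfectMatching σ⊆G = record
    { isMatching = record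
      { subset   = λ u v u~v → σ⊆G (T-does⁻ (σ u ≟ v) u~v)
      ; disjoint = λ u v w u~v u~w → trans (sym (T-does⁻ (σ u ≟ v) u~v)) (T-does⁻ (σ u ≟ w) u~w)
      }
    ; covers = λ u → σ u , T-does⁺ (σ u ≟ σ u) refl
    }

4+-cong : ∀ {n} {i j : Fin n} → i ≡ j → Fin.suc (suc (suc (suc i))) ≡ suc (suc (suc (suc j)))
4+-cong = cong (λ i → suc (suc (suc (suc i))))

-- The edges 01, i(i+2) and (ν−2)(ν−1) form a Hamiltonian cycle on {0, …, ν−1},
-- with perfect matchings rungs and blocks; crossed replaces the edges 02 and 13
-- of blocks by the chords 03 and 12. The union of the three matchings is a K₄
-- on 0, 1, 2, 3 whose edge 23 is subdivided ν − 4 times.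
blocks : ∀ t → Fin (t * 2) → Fin (t * 2)
blocks 1             zero                          = suc zero
blocks 1             (suc zero)                    = zero
blocks (suc (suc t)) zero                          = suc (suc zero)
blocks (suc (suc t)) (suc zero)                    = suc (suc (suc zero))
blocks (suc (suc t)) (suc (suc zero))              = zero
blocks (suc (suc t)) (suc (suc (suc zero)))        = suc zero
blocks (suc (suc t)) (suc (suc (suc (suc i))))     = suc (suc (suc (suc (blocks t i))))

rungs : ∀ t → Fin (suc t * 2) → Fin (suc t * 2)
rungs t zero          = suc zero
rungs t (suc zero)    = zero
rungs t (suc (suc i)) = suc (suc (blocks t i))

crossed : ∀ t → Fin (suc (suc t) * 2) → Fin (suc (suc t) * 2)
crossed t zero                      = suc (suc (suc zero))
crossed t (suc zero)                = suc (suc zero)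
crossed t (suc (suc zero))          = suc zero
crossed t (suc (suc (suc zero)))    = zero
crossed t (suc (suc (suc (suc i)))) = suc (suc (suc (suc (blocks t i))))

blocks-involutive : ∀ t i → blocks t (blocks t i) ≡ i
blocks-involutive 1             zero                      = refl
blocks-involutive 1             (suc zero)                = refl
blocks-involutive (suc (suc t)) zero                      = refl
blocks-involutive (suc (suc t)) (suc zero)                = refl
blocks-involutive (suc (suc t)) (suc (suc zero))          = refl
blocks-involutive (suc (suc t)) (suc (suc (suc zero)))    = refl
blocks-involutive (suc (suc t)) (suc (suc (suc (suc i)))) = 4+-cong (blocks-involutive t i)

rungs-involutive : ∀ t i → rungs t (rungs t i) ≡ i
rungs-involutive t zero          = refl
rungs-involutive t (suc zero)    = refl
rungs-involutive t (suc (suc i)) = cong (λ i → suc (suc i)) (blocks-involutive t i)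

crossed-involutive : ∀ t i → crossed t (crossed t i) ≡ i
crossed-involutive t zero                      = refl
crossed-involutive t (suc zero)                = refl
crossed-involutive t (suc (suc zero))          = refl
crossed-involutive t (suc (suc (suc zero)))    = refl
crossed-involutive t (suc (suc (suc (suc i)))) = 4+-cong (blocks-involutive t i)

2+-injective : ∀ {n} {i j : Fin n} → Fin.suc (suc i) ≡ suc (suc j) → i ≡ j
2+-injective = suc-injective ∘ suc-injective

blocks-fpf : ∀ t i → blocks t i ≢ i
blocks-fpf 1             zero                      ()
blocks-fpf 1             (suc zero)                ()
blocks-fpf (suc (suc t)) zero                      ()
blocks-fpf (suc (suc t)) (suc zero)                ()
blocks-fpf (suc (suc t)) (suc (suc zero))          ()
blocks-fpf (suc (suc t)) (suc (suc (suc zero)))    ()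
blocks-fpf (suc (suc t)) (suc (suc (suc (suc i)))) = blocks-fpf t i ∘ 2+-injective ∘ 2+-injective

rungs-fpf : ∀ t i → rungs t i ≢ i
rungs-fpf t zero          ()
rungs-fpf t (suc zero)    ()
rungs-fpf t (suc (suc i)) = blocks-fpf t i ∘ 2+-injective

crossed-fpf : ∀ t i → crossed t i ≢ i
crossed-fpf t zero                      ()
crossed-fpf t (suc zero)                ()
crossed-fpf t (suc (suc zero))          ()
crossed-fpf t (suc (suc (suc zero)))    ()
crossed-fpf t (suc (suc (suc (suc i)))) = blocks-fpf t i ∘ 2+-injective ∘ 2+-injective

-- For `t = 0` both matchings are the single edge 01 and the cycle degenerates to it; the induction
-- for connectedness starts there.
OnCycle : ∀ t → Rel (Fin (suc t * 2)) 0ℓ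
OnCycle t u v = rungs t u ≡ v ⊎ blocks (suc t) u ≡ v

-- The cycle on ν + 2 vertices is the shifted cycle on ν vertices with the edge
-- 23 replaced by the path 2, 0, 1, 3.
cycle-shift : ∀ t {u v} → OnCycle t u v → Star (OnCycle (suc t)) (suc (suc u)) (suc (suc v))
cycle-shift t                 (inj₂ refl) = inj₁ refl ◅ ε
cycle-shift t {zero}          (inj₁ refl) = inj₂ refl ◅ inj₁ refl ◅ inj₂ refl ◅ ε
cycle-shift t {suc zero}      (inj₁ refl) = inj₂ refl ◅ inj₁ refl ◅ inj₂ refl ◅ ε
cycle-shift t {suc (suc u)}   (inj₁ refl) = inj₂ refl ◅ ε

-- A path from `u` to 0 on the smaller cycle becomes a path from `u + 2` to 2, and the edge 02 of
-- `blocks` completes it.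
cycle-connected : ∀ t u → Star (OnCycle t) u zero
cycle-connected t       zero          = ε
cycle-connected t       (suc zero)    = inj₁ refl ◅ ε
cycle-connected (suc t) (suc (suc u)) =
  kleisliStar (λ i → suc (suc i)) (cycle-shift t) (cycle-connected t u) ◅◅ inj₂ refl ◅ ε

module Extremal (t : ℕ) where
  ν : ℕ
  ν = suc (suc t) * 2

  module Rungs   = Involution (rungs (suc t)) (rungs-involutive (suc t)) (rungs-fpf (suc t))
  module Blocks  = Involution (blocks (suc (suc t))) (blocks-involutive (suc (suc t))) (blocks-fpf (suc (suc t)))
  module Crossed = Involution (crossed t) (crossed-involutive t) (crossed-fpf t)

  Adjacent : Rel (Fin ν) 0ℓ
  Adjacent u v = OnCycle (suc t) u v ⊎ crossed t u ≡ v

  adjacent? : Decidable Adjacent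
  adjacent? u v = ((rungs (suc t) u ≟ v) ⊎-dec (blocks (suc (suc t)) u ≟ v)) ⊎-dec (crossed t u ≟ v)

  adjacent-sym : Symmetric Adjacent
  adjacent-sym (inj₁ (inj₁ eq)) = inj₁ (inj₁ (Rungs.σ-sym eq))
  adjacent-sym (inj₁ (inj₂ eq)) = inj₁ (inj₂ (Blocks.σ-sym eq))
  adjacent-sym (inj₂ eq)        = inj₂ (Crossed.σ-sym eq)

  adjacent-irrefl : ∀ v → ¬ Adjacent v v
  adjacent-irrefl v (inj₁ (inj₁ eq)) = rungs-fpf (suc t) v eq
  adjacent-irrefl v (inj₁ (inj₂ eq)) = blocks-fpf (suc (suc t)) v eq
  adjacent-irrefl v (inj₂ eq)        = crossed-fpf t v eq

  G : Graph ν
  G = fromRelation adjacent? adjacent-sym adjacent-irrefl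

  open Graph G using (_~_)

  ~⁺ : ∀ u v → Adjacent u v → u ~ v
  ~⁺ u v = T-does⁺ (adjacent? u v)

  ~⁻ : ∀ u v → u ~ v → Adjacent u v
  ~⁻ u v = T-does⁻ (adjacent? u v)

  4≤ν : 4 ≤ ν
  4≤ν = s≤s (s≤s (s≤s (s≤s z≤n)))

  connected : Connected G
  connected u v = to-zero u ◅◅ reverse (λ {u} {v} → ~-sym G {u} {v}) (to-zero v)
    where
    to-zero : ∀ u → Star _~_ u zero
    to-zero u = gmap id (λ {u} {v} u~v → ~⁺ u v (inj₁ u~v)) (cycle-connected (suc t) u)

  -- Adjacency is the union of three perfect matchings, so the reason for an adjacency names a
  -- perfect matching through that edge.
  edgeInPM : EveryEdgeInPerfectMatching G
  edgeInPM {u} {v} u~v with ~⁻ u v u~v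
  ... | inj₁ (inj₁ eq) =
    Rungs.graph , Rungs.isPerfectMatching {G} (~⁺ _ _ ∘ inj₁ ∘ inj₁) , T-does⁺ (rungs (suc t) u ≟ v) eq
  ... | inj₁ (inj₂ eq) =
    Blocks.graph , Blocks.isPerfectMatching {G} (~⁺ _ _ ∘ inj₁ ∘ inj₂) , T-does⁺ (blocks (suc (suc t)) u ≟ v) eq
  ... | inj₂ eq        =
    Crossed.graph , Crossed.isPerfectMatching {G} (~⁺ _ _ ∘ inj₂) , T-does⁺ (crossed t u ≟ v) eq

  extendable : Extendable 1 G
  extendable = edgeInPM⇒extendable₁ 4≤ν connected {zero} {suc zero} (~⁺ zero (suc zero) (inj₁ (inj₁ refl))) edgeInPM

  -- The vertices 0, 1, 2 form a triangle: 01 lies in `rungs`, 02 in `blocks` and 12 in `crossed`.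
  nonBipartite : ¬ Bipartite G
  nonBipartite (side , proper) = no-three (side zero) (side (suc zero)) (side (suc (suc zero)))
    (proper zero (suc zero) (~⁺ zero (suc zero) (inj₁ (inj₁ refl))))
    (proper zero (suc (suc zero)) (~⁺ zero (suc (suc zero)) (inj₁ (inj₂ refl))))
    (proper (suc zero) (suc (suc zero)) (~⁺ (suc zero) (suc (suc zero)) (inj₂ refl)))
    where
    no-three : ∀ a b c → a ≢ b → a ≢ c → b ≢ c → ⊥
    no-three true  true  _     a≢b _   _   = a≢b refl
    no-three false false _     a≢b _   _   = a≢b refl
    no-three true  false true  _   a≢c _   = a≢c refl
    no-three false true  false _   a≢c _   = a≢c refl
    no-three true  false false _   _   b≢c = b≢c refl
    no-three false true  true  _   _   b≢c = b≢c refl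

  degree≤3 : ∀ u → degree G u ≤ 3
  degree≤3 u = degree-≤ G {u} (rungs (suc t) u ∷ blocks (suc (suc t)) u ∷ crossed t u ∷ []) (∈-images ∘ ~⁻ u _)
    where
    ∈-images : ∀ {v} → Adjacent u v → v ∈ rungs (suc t) u ∷ blocks (suc (suc t)) u ∷ crossed t u ∷ []
    ∈-images (inj₁ (inj₁ eq)) = here (sym eq)
    ∈-images (inj₁ (inj₂ eq)) = there (here (sym eq))
    ∈-images (inj₂ eq)        = there (there (here (sym eq)))

  -- From vertex 4 on, `crossed` agrees with `blocks`, so its image is already listed.
  degree≤2 : ∀ i → degree G (suc (suc (suc (suc i)))) ≤ 2
  degree≤2 i = degree-≤ G {u} (rungs (suc t) u ∷ blocks (suc (suc t)) u ∷ []) (∈-images ∘ ~⁻ u _)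
    where
    u : Fin ν
    u = suc (suc (suc (suc i)))
    ∈-images : ∀ {v} → Adjacent u v → v ∈ rungs (suc t) u ∷ blocks (suc (suc t)) u ∷ []
    ∈-images (inj₁ (inj₁ eq)) = here (sym eq)
    ∈-images (inj₁ (inj₂ eq)) = there (here (sym eq))
    ∈-images (inj₂ eq)        = there (here (sym eq))

  -- Four vertices of degree at most 3 and `ν - 4 = 2t` vertices of degree at most 2 give a degree
  -- sum of at most `12 + 4t = 2(ν + 2)`.
  ∣E∣≤ν+2 : ∣E∣ G ≤ ν + 2
  ∣E∣≤ν+2 = ℕ.*-cancelʳ-≤ (∣E∣ G) (ν + 2) 2 (begin
    ∣E∣ G * 2                              ≡⟨ double (∣E∣ G) ⟩
    ∣E∣ G + ∣E∣ G                          ≤⟨ 2∣E∣≤∑degree G ⟩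
    sumℕ (degree G)                        ≤⟨ ℕ.+-mono-≤ (degree≤3 zero)
                                             (ℕ.+-mono-≤ (degree≤3 (suc zero))
                                             (ℕ.+-mono-≤ (degree≤3 (suc (suc zero)))
                                             (ℕ.+-mono-≤ (degree≤3 (suc (suc (suc zero))))
                                             (sumℕ-≤ 2 degree≤2)))) ⟩
    3 + (3 + (3 + (3 + t * 2 * 2)))        ≡⟨ count t ⟩
    (ν + 2) * 2                            ∎)
    where
    open ℕ.≤-Reasoning
    double : ∀ m → m * 2 ≡ m + m
    double = ℕ-Solver.solve-∀
    count : ∀ t → 3 + (3 + (3 + (3 + t * 2 * 2))) ≡ (suc (suc t) * 2 + 2) * 2
    count = ℕ-Solver.solve-∀

theorem3p1 : ∀ (ν : ℕ) → 2 ∣ ν → 4 ≤ ν → ε[ ν , 1 ]≡ (ν + 2)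
theorem3p1 .(suc (suc t) * 2) (divides (suc (suc t)) refl) 4≤ν =
  ( G , extendable , nonBipartite
  -- The degree count gives one inequality; the lower bound applied to `G` itself gives the other.
  , ℕ.≤-antisym ∣E∣≤ν+2 (ν+2≤∣E∣ {G = G} 4≤ν connected nonBipartite edgeInPM) ) ,
  λ { _ (H , ext , ¬bip , refl) →
      ν+2≤∣E∣ {G = H} 4≤ν (Extendable.connected ext) ¬bip (extendable₁⇒edgeInPM ext) }
  where open Extremal t using (G; extendable; nonBipartite; ∣E∣≤ν+2; connected; edgeInPM)
theorem3p1 .2 (divides 1 refl) (s≤s (s≤s ()))
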